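{- Let $m,n\geq 2$ and $c_{\mathrm{small}}\geq 0$ be integers, and let $T$ be a tournament that contains neither $A_m$ nor $D_n$, such that every subtournament $T'$ of $T$ with $\overrightarrow{\omega}(T')\geq c_{\mathrm{small}}$ contains a copy of $A_{m-1}$ and a copy of $D_{n-1}$. Let $c,a$ be nonnegative integers with $c\geq 2\cdot m!\cdot a+c_{\mathrm{small}}$, and let $(Q_1,\dots,Q_r)$ be a $(c,a)$-near-bag-chain in $T$. Then $\overrightarrow{\omega}\big(\bigcup_{i=1}^r Q_i\big)\leq 4mc$.
   Context: A tournament is a finite directed graph with exactly one arc between each pair of distinct vertices; $N^+(v)$, $N^-(v)$ denote out- and in-neighbourhoods. For a total ordering $<$ of $V(T)$, the backedge graph $B(T,<)$ is the graph on $V(T)$ with an edge $uv$ for every pair $u<v$ with $vu \in A(T)$; $\overrightarrow{\omega}(T)=\min_<\omega(B(T,<))$ over all total orderings, and for $X\subseteq V(T)$, $\overrightarrow{\omega}(X)=\overrightarrow{\omega}(T[X])$. A tournament contains (a copy of) $H$ if some induced subtournament is isomorphic to $H$. For disjoint vertex sets $X,Y$, $X\Rightarrow Y$ means $xy$ is an arc for all $x\in X,y\in Y$. The tournament $A_1$ is a single vertex; for $k\ge 2$, $A_k$ consists of vertex-disjoint tournaments $T_1,\dots,T_{k-1}$, each isomorphic to $A_{k-1}$, and further vertices $v_1,\dots,v_k$, with: $A_k[V(T_i)]=T_i$; $v_j\Rightarrow v_i$ whenever $i<j$; $V(T_i)\Rightarrow V(T_j)$ whenever $i<j$; $v_i\Rightarrow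 V(T_j)$ whenever $i\le j$; and $V(T_j)\Rightarrow v_i$ whenever $i>j$. The tournament $D_1$ is a single vertex, and $D_k$ is obtained from two disjoint copies $T_1,T_2$ of $D_{k-1}$ and one further vertex $w$ with $V(T_1)\Rightarrow V(T_2)$, $V(T_2)\Rightarrow w$, $w \Rightarrow V(T_1)$. A $(c,a)$-near-bag-chain in $T$ is a sequence $(Q_1,\dots,Q_r)$ of pairwise disjoint subsets of $V(T)$ such that for all $i\in\{1,\dots,r\}$: $\overrightarrow{\omega}(Q_i)\le c$; for all $v\in Q_i$, $\overrightarrow{\omega}(N^-(v)\cap\bigcup_{j>i}Q_j)\le a$; and for all $v\in Q_i$, $\overrightarrow{\omega}(N^+(v)\cap\bigcup_{j<i}Q_j)\le a$. -}

module Defs where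

open import Data.Nat using (ℕ; zero; suc; _<_; _≤_; _<ᵇ_; _≤ᵇ_)
open import Data.Fin using (Fin; toℕ)
open import Data.Bool using (Bool; true; false; not; _∧_)
open import Data.Empty using (⊥)
open import Data.Unit using (⊤; tt)
open import Data.Sum using (_⊎_; inj₁; inj₂)
open import Data.Product using (Σ; ∃; _×_; _,_)
open import Relation.Binary.PropositionalEquality using (_≡_; _≢_)
open import Relation.Nullary using (¬_)

record Tournament (N : ℕ) : Set where
  field
    arc    : Fin N → Fin N → Bool
    irrefl : ∀ v → arc v v ≡ false
    tourn  : ∀ u v → u ≢ v → arc u v ≡ not (arc v u)
open Tournament public

VSet : ℕ → Set₁
VSet N = Fin N → Set

record Pattern : Set₁ where
  field
    Vtx  : Set
    parc : Vtx → Vtx → Bool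
open Pattern public

-- Backedge clique of size s in B(T[X], <), where the ordering < of X is
-- given by rank (u < v iff rank u < rank v): s distinct vertices of X,
-- pairwise forming back edges (earlier one is an out-neighbour of later one).
IsBackClique : ∀ {N} → Tournament N → VSet N → (Fin N → ℕ) → (s : ℕ) → (Fin s → Fin N) → Set
IsBackClique T X rank s f =
  (∀ i → X (f i)) ×
  (∀ i j → f i ≡ f j → i ≡ j) ×
  (∀ i j → rank (f i) < rank (f j) → arc T (f j) (f i) ≡ true)

-- ω→(X) ≤ k : some total ordering of X (injective rank on X) whose backedge
-- graph has clique number at most k.
OmegaLe : ∀ {N} → Tournament N → VSet N → ℕ → Set
OmegaLe {N} T X k =
  Σ (Fin N → ℕ) λ rank →
    (∀ u v → X u → X v → rank u ≡ rank v → u ≡ v) ×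
    (∀ s (f : Fin s → Fin N) → IsBackClique T X rank s f → s ≤ k)

OmegaGe : ∀ {N} → Tournament N → VSet N → ℕ → Set
OmegaGe T X c = ∀ k → OmegaLe T X k → c ≤ k

Contains : ∀ {N} → Tournament N → VSet N → Pattern → Set
Contains {N} T X H =
  Σ (Vtx H → Fin N) λ f →
    (∀ u v → f u ≡ f v → u ≡ v) ×
    (∀ v → X (f v)) ×
    (∀ u v → arc T (f u) (f v) ≡ parc H u v)

-- The tournament A_k (k ≥ 1). For k ≥ 2 the vertices are
-- inj₁ (i , x) : vertex x of copy T_{i+1} (i : Fin (k-1)),
-- inj₂ j       : vertex v_{j+1}          (j : Fin k).
AV : ℕ → Set
AV zero = ⊥
AV (suc zero) = ⊤
AV (suc (suc k)) = (Fin (suc k) × AV (suc k)) ⊎ Fin (suc (suc k))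

aArc : ∀ k → AV k → AV k → Bool
aArc zero () _
aArc (suc zero) _ _ = false
aArc (suc (suc k)) (inj₁ (i , x)) (inj₁ (j , y)) with toℕ i Data.Nat.≟ toℕ j
... | Relation.Nullary.yes _ = aArc (suc k) x y
... | Relation.Nullary.no _ = toℕ i <ᵇ toℕ j
aArc (suc (suc k)) (inj₂ a) (inj₂ b) = toℕ b <ᵇ toℕ a
aArc (suc (suc k)) (inj₂ a) (inj₁ (j , _)) = toℕ a ≤ᵇ toℕ j
aArc (suc (suc k)) (inj₁ (j , _)) (inj₂ a) = toℕ j <ᵇ toℕ a

A : ℕ → Pattern
A k = record { Vtx = AV k ; parc = aArc k }

-- The tournament D_k (k ≥ 1). For k ≥ 2: inj₁ (false , x) in T_1,
-- inj₁ (true , x) in T_2, inj₂ tt is w.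
DV : ℕ → Set
DV zero = ⊥
DV (suc zero) = ⊤
DV (suc (suc k)) = (Bool × DV (suc k)) ⊎ ⊤

dArc : ∀ k → DV k → DV k → Bool
dArc zero () _
dArc (suc zero) _ _ = false
dArc (suc (suc k)) (inj₁ (false , x)) (inj₁ (false , y)) = dArc (suc k) x y
dArc (suc (suc k)) (inj₁ (true , x)) (inj₁ (true , y)) = dArc (suc k) x y
dArc (suc (suc k)) (inj₁ (false , _)) (inj₁ (true , _)) = true
dArc (suc (suc k)) (inj₁ (true , _)) (inj₁ (false , _)) = false
dArc (suc (suc k)) (inj₁ (true , _)) (inj₂ _) = true
dArc (suc (suc k)) (inj₁ (false , _)) (inj₂ _) = false
dArc (suc (suc k)) (inj₂ _) (inj₁ (false , _)) = true
dArc (suc (suc k)) (inj₂ _) (inj₁ (true , _)) = false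
dArc (suc (suc k)) (inj₂ _) (inj₂ _) = false

D : ℕ → Pattern
D k = record { Vtx = DV k ; parc = dArc k }

InN : ∀ {N} → Tournament N → Fin N → VSet N
InN T v u = arc T u v ≡ true

OutN : ∀ {N} → Tournament N → Fin N → VSet N
OutN T v u = arc T v u ≡ true

_∩_ : ∀ {N} → VSet N → VSet N → VSet N
(X ∩ Y) u = X u × Y u

UnionAbove : ∀ {N r} → (Fin r → VSet N) → Fin r → VSet N
UnionAbove {r = r} Q i u = Σ (Fin r) λ j → (toℕ i < toℕ j) × Q j u

UnionBelow : ∀ {N r} → (Fin r → VSet N) → Fin r → VSet N
UnionBelow {r = r} Q i u = Σ (Fin r) λ j → (toℕ j < toℕ i) × Q j u

UnionAll : ∀ {N r} → (Fin r → VSet N) → VSet N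
UnionAll {r = r} Q u = Σ (Fin r) λ j → Q j u

NearBagChain : ∀ {N} → Tournament N → ℕ → ℕ → (r : ℕ) → (Fin r → VSet N) → Set
NearBagChain T c a r Q =
  (∀ i j v → Q i v → Q j v → i ≡ j) ×
  (∀ i → OmegaLe T (Q i) c) ×
  (∀ i v → Q i v → OmegaLe T (InN T v ∩ UnionAbove Q i) a) ×
  (∀ i v → Q i v → OmegaLe T (OutN T v ∩ UnionBelow Q i) a)

{-# OPTIONS --safe #-}
module Submission where

-- Merge consecutive bags greedily into blocks: close the current block as soon as its clique
-- number exceeds c.  Every block then has clique number at most 2c, and every block but the last
-- has at least c.  Order the blocks one after the other, each internally by an optimal ordering.
-- A backedge clique with more than 2m · 2c vertices meets 2m + 1 blocks.  Take its vertices in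
-- every other such block as v_1, …, v_m, and look for the copies T_i of A_{m-1} in the blocks in
-- between.  Making a block point the right way with respect to one vertex outside it costs at most
-- a, and A_m has at most 2 · m! vertices, so clique number at least csmall always remains and the
-- next copy exists; together they form A_m.
--
-- Membership in the bags need not be decidable.  If T has clique number at most csmall (which is
-- decidable by finite search) there is nothing to prove, and otherwise the hypothesis on csmall
-- yields excluded middle.

open import Defs
open import Data.Nat using (ℕ; _+_; _*_; _≤_; _∸_; _!; zero; suc; _<_; z≤n; s≤s; _≟_; _<?_; _≤?_)
open import Data.Nat.Properties
open import Data.Nat.Solver using (module +-*-Solver)
open import Data.Fin using (Fin; toℕ; fromℕ<; inject≤)
open import Data.Fin.Properties using (any?; all?; toℕ-fromℕ<; toℕ<n; toℕ-injective; inject≤-injective)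
import Data.Fin.Properties as Fin
open import Data.Fin.Subset using (Subset; _∈_)
open import Data.Fin.Subset.Properties using (p⊂q⇒∣p∣<∣q∣; ∣p∣≤n)
open import Data.Bool using (Bool; true; false; not)
import Data.Bool as Bool
open import Data.Bool.Properties using (¬-not)
open import Data.List using (List; []; _∷_; _++_; length; map; filter; upTo; allFin; concatMap)
import Data.List as List
open import Data.List.Properties using (length-map; length-++; length-upTo; length-tabulate)
open import Data.List.Extrema.Nat using (argmin; f[argmin]≤f[⊤]; f[argmin]≤f[xs]; argmin-sel)
open import Data.List.Membership.Propositional renaming (_∈_ to _∈ₗ_) using (lose)
open import Data.List.Membership.Propositional.Properties
open import Data.List.Relation.Unary.Any using (here; there)
open import Data.List.Relation.Unary.All using (All; []; _∷_)
import Data.List.Relation.Unary.All as All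
import Data.List.Relation.Unary.All.Properties as All
open import Data.List.Relation.Unary.AllPairs using ([]; _∷_)
open import Data.List.Relation.Unary.Unique.Propositional using (Unique)
import Data.List.Relation.Unary.Unique.Propositional.Properties as Unique
open import Data.Product using (Σ; ∃; _×_; _,_; proj₁; proj₂)
open import Data.Sum using (_⊎_; inj₁; inj₂; [_,_]′)
open import Data.Unit using (⊤; tt)
open import Data.Vec using (Vec; []; _∷_; lookup; tabulate)
open import Data.Vec.Properties using (lookup∘tabulate; []=⇒lookup; lookup⇒[]=)
open import Function using (_∘_; case_of_)
open import Relation.Binary using (tri<; tri≈; tri>)
open import Relation.Binary.PropositionalEquality using (_≡_; _≢_; refl; sym; trans; cong; cong₂; subst; subst₂)
open import Relation.Nullary using (¬_; Dec; yes; no; does; contradiction)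
open import Relation.Nullary.Decidable using (¬?; map′; _×-dec_; _→-dec_; ¬¬-excluded-middle; dec-true)
open import Relation.Unary using (Decidable)
open +-*-Solver using (solve; con; _:*_; _:+_; _:=_)

-- Lists, search over vectors, and compression of rankings.

lookup-injective : {A : Set} {xs : List A} → Unique xs →
  ∀ i j → List.lookup xs i ≡ List.lookup xs j → i ≡ j
lookup-injective (_ ∷ _)  Fin.zero    Fin.zero    _  = refl
lookup-injective (p ∷ _)  Fin.zero    (Fin.suc j) eq = contradiction eq (All.lookup p (∈-lookup j))
lookup-injective (p ∷ _)  (Fin.suc i) Fin.zero    eq = contradiction (sym eq) (All.lookup p (∈-lookup i))
lookup-injective (_ ∷ ps) (Fin.suc i) (Fin.suc j) eq = cong Fin.suc (lookup-injective ps i j eq)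

length-filter-split : {A : Set} {P : A → Set} (P? : Decidable P) (xs : List A) →
  length xs ≡ length (filter P? xs) + length (filter (¬? ∘ P?) xs)
length-filter-split P? [] = refl
length-filter-split P? (x ∷ xs) with P? x
... | yes _ = cong suc (length-filter-split P? xs)
... | no  _ = trans (cong suc (length-filter-split P? xs)) (sym (+-suc _ _))

length-concatMap : {A B : Set} (f : A → List B) (l : ℕ) → (∀ x → length (f x) ≡ l) →
  ∀ xs → length (concatMap f xs) ≡ length xs * l
length-concatMap f l eq []       = refl
length-concatMap f l eq (x ∷ xs) =
  trans (length-++ (f x)) (cong₂ _+_ (eq x) (length-concatMap f l eq xs))

anyVec? : ∀ {M} n {P : Vec (Fin M) n → Set} → Decidable P → Dec (∃ P)
anyVec? zero    P? = map′ (λ p → [] , p) (λ { ([] , p) → p }) (P? [])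
anyVec? (suc n) P? = map′ (λ { (x , xs , p) → x ∷ xs , p }) (λ { (x ∷ xs , p) → x , xs , p })
  (any? λ x → anyVec? n (λ xs → P? (x ∷ xs)))

bounded : ∀ {N} (f : Fin N → ℕ) → ∃ λ M → ∀ u → f u < M
bounded {zero}  f = 0 , λ ()
bounded {suc N} f with bounded (f ∘ Fin.suc)
... | M , f<M = suc (f Fin.zero) + M , λ
  { Fin.zero → m≤m+n _ M ; (Fin.suc u) → <-≤-trans (f<M u) (m≤n+m M _) }

module _ {N : ℕ} (rank : Fin N → ℕ) where

  below : Fin N → Subset N
  below u = tabulate λ v → does (rank v <? rank u)

  ∈-below⁺ : ∀ {u v} → rank v < rank u → v ∈ below u
  ∈-below⁺ {u} {v} lt = lookup⇒[]= v (below u)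
    (trans (lookup∘tabulate (λ v → does (rank v <? rank u)) v) (dec-true (rank v <? rank u) lt))

  ∈-below⁻ : ∀ {u v} → v ∈ below u → rank v < rank u
  ∈-below⁻ {u} {v} v∈ = <ᵇ⇒< (rank v) (rank u) (subst Bool.T
    (trans (sym ([]=⇒lookup v∈)) (lookup∘tabulate (λ v → does (rank v <? rank u)) v)) tt)

  -- Counts the vertices of smaller rank. The order is kept, ties included, while all values are at
  -- most `N`, so that rankings can be searched exhaustively.
  compress : Fin N → Fin (suc N)
  compress u = fromℕ< (s≤s (∣p∣≤n (below u)))

  compress-mono : ∀ {u v} → rank u < rank v → toℕ (compress u) < toℕ (compress v)
  compress-mono {u} {v} lt = subst₂ _<_ (sym (toℕ-fromℕ< _)) (sym (toℕ-fromℕ< _))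
    (p⊂q⇒∣p∣<∣q∣ ((λ w∈ → ∈-below⁺ (<-trans (∈-below⁻ w∈) lt)) , u , ∈-below⁺ lt , λ u∈ → <-irrefl refl (∈-below⁻ u∈)))

  compress-reflects-≡ : ∀ {u v} → compress u ≡ compress v → rank u ≡ rank v
  compress-reflects-≡ {u} {v} eq with <-cmp (rank u) (rank v)
  ... | tri< lt _ _ = contradiction (cong toℕ eq) (<⇒≢ (compress-mono lt))
  ... | tri≈ _ e _  = e
  ... | tri> _ _ gt = contradiction (cong toℕ (sym eq)) (<⇒≢ (compress-mono gt))

-- Recursive choice in which a new term may depend on all earlier ones and on their properties; the
-- copies of A_{m-1} are found in this way. `φ₀` only fills indices about which nothing is claimed.
sequence : {Φ : Set} {Good : ℕ → Φ → Set} {R : Φ → Φ → Set} → Φ → ∀ n →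
  (∀ p → p < n → (φ : ℕ → Φ) → (∀ {j} → j < p → Good j (φ j)) →
    Σ Φ λ ψ → Good p ψ × (∀ {j} → j < p → R (φ j) ψ)) →
  Σ (ℕ → Φ) λ φ → (∀ {j} → j < n → Good j (φ j)) × (∀ {i j} → i < j → j < n → R (φ i) (φ j))
sequence φ₀ zero _ = (λ _ → φ₀) , (λ ()) , λ _ ()
sequence {Φ} {Good} {R} φ₀ (suc n) extend with sequence {Good = Good} {R} φ₀ n (λ p p<n → extend p (m<n⇒m<1+n p<n))
... | φ , good , related with extend n ≤-refl φ good
...   | ψ , goodψ , relatedψ = φ′ , good′ , related′
  where
  φ′ : ℕ → Φ
  φ′ j with j <? n
  ... | yes _ = φ j
  ... | no  _ = ψ
  good′ : ∀ {j} → j < suc n → Good j (φ′ j)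
  good′ {j} (s≤s j≤n) with j <? n
  ... | yes j<n = good j<n
  ... | no  j≮n = subst (λ i → Good i ψ) (≤-antisym (≮⇒≥ j≮n) j≤n) goodψ
  related′ : ∀ {i j} → i < j → j < suc n → R (φ′ i) (φ′ j)
  related′ {i} {j} i<j (s≤s j≤n) with i <? n | j <? n
  ... | yes i<n | yes j<n = related i<j j<n
  ... | yes i<n | no  _   = relatedψ i<n
  ... | no  i≮n | _       = contradiction (<-≤-trans i<j j≤n) i≮n

-- The number of vertices of A_k.

n≤n! : ∀ n → n ≤ n !
n≤n! zero    = z≤n
n≤n! (suc n) = ≤-trans (≤-reflexive (sym (*-identityʳ (suc n)))) (*-monoʳ-≤ (suc n) (1≤n! n))

-- Rests on (k+2)! = (k+1)·(k+1)! + (k+1)! and k+2 ≤ 2·(k+1)!. It is the induction step for the size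
-- of A_{k+2}, and it also bounds the number of vertices against which a block has to be pruned: `p`
-- earlier copies and the k+2 vertices v_i.
A-size-step : ∀ k {p s} → p ≤ suc k → s ≤ 2 * (suc k !) → p * s + (2 + k) ≤ 2 * ((2 + k) !)
A-size-step k {p} {s} p≤ s≤ = begin
  p * s + (2 + k)                         ≤⟨ +-mono-≤ (*-mono-≤ p≤ s≤) small ⟩
  suc k * (2 * (suc k !)) + 2 * (suc k !) ≡⟨ solve 2 (λ k F → (con 1 :+ k) :* (con 2 :* F) :+ con 2 :* F
                                               := con 2 :* ((con 2 :+ k) :* F)) refl k (suc k !) ⟩
  2 * ((2 + k) !)                         ∎
  where
  open ≤-Reasoning
  small : 2 + k ≤ 2 * (suc k !)
  small = begin
    2 + k                 ≡⟨ +-suc 1 k ⟨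
    1 + suc k             ≤⟨ +-mono-≤ (1≤n! (suc k)) (n≤n! (suc k)) ⟩
    suc k ! + suc k !     ≡⟨ cong (suc k ! +_) (+-identityʳ _) ⟨
    2 * (suc k !)         ∎

A-vertices : ∀ k → Σ (List (AV k)) λ xs → (∀ x → x ∈ₗ xs) × length xs ≤ 2 * (k !)
A-vertices zero = [] , (λ ()) , z≤n
A-vertices (suc zero) = tt ∷ [] , (λ _ → here refl) , s≤s z≤n
A-vertices (suc (suc k)) with A-vertices (suc k)
... | xs , complete , size = ys ++ zs , complete′ , size′
  where
  row : Fin (suc k) → List (AV (2 + k))
  row i = map (λ x → inj₁ (i , x)) xs
  ys zs : List (AV (2 + k))
  ys = concatMap row (allFin (suc k))
  zs = map inj₂ (allFin (2 + k))
  complete′ : ∀ x → x ∈ₗ ys ++ zs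
  complete′ (inj₁ (i , x)) = ∈-++⁺ˡ (∈-concatMap⁺ row (lose (∈-allFin i) (∈-map⁺ (λ x → inj₁ (i , x)) (complete x))))
  complete′ (inj₂ i)       = ∈-++⁺ʳ ys (∈-map⁺ inj₂ (∈-allFin i))
  size′ : length (ys ++ zs) ≤ 2 * ((2 + k) !)
  size′ = begin
    length (ys ++ zs)            ≡⟨ length-++ ys ⟩
    length ys + length zs        ≡⟨ cong₂ _+_
                                      (length-concatMap row (length xs) (λ i → length-map _ xs) (allFin (suc k)))
                                      (length-map inj₂ (allFin (2 + k))) ⟩
    length (allFin (suc k)) * length xs + length (allFin (2 + k))
                                 ≡⟨ cong₂ (λ a b → a * length xs + b)
                                      (length-tabulate {n = suc k} (λ i → i)) (length-tabulate {n = 2 + k} (λ i → i)) ⟩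
    suc k * length xs + (2 + k)  ≤⟨ A-size-step k ≤-refl size ⟩
    2 * ((2 + k) !)              ∎
    where open ≤-Reasoning

-- Recognising a copy of A_k by its arcs.

module _ {N : ℕ} (T : Tournament N) where

  arc-flip : ∀ {u v} → u ≢ v → ¬ arc T u v ≡ true → arc T v u ≡ true
  arc-flip {u} {v} u≢v ¬uv = trans (tourn T v u (u≢v ∘ sym)) (cong not (¬-not ¬uv))

  arc⇒≢ : ∀ {u v} → arc T u v ≡ true → u ≢ v
  arc⇒≢ {u} uv refl = contradiction (trans (sym uv) (irrefl T u)) λ ()

  arc-asym : ∀ {u v} → arc T u v ≡ true → arc T v u ≡ false
  arc-asym {u} {v} uv = trans (tourn T v u (arc⇒≢ uv ∘ sym)) (cong not uv)

  -- The boolean tests in `aArc` are definitionally `does` of `<?` and `≤?`, so each mixed case of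
  -- `f-arc` becomes one application of this.
  arc-does : ∀ {P : Set} (P? : Dec P) {u v} → (P → arc T u v ≡ true) → (¬ P → arc T u v ≡ false) →
    arc T u v ≡ does P?
  arc-does (yes p) t f = t p
  arc-does (no ¬p) t f = f ¬p

  module _ {k : ℕ} (v : Fin (2 + k) → Fin N) (φ : Fin (suc k) → AV (suc k) → Fin N)
    (φ-arc  : ∀ i x z → arc T (φ i x) (φ i z) ≡ aArc (suc k) x z)
    (φ-inj  : ∀ i x z → φ i x ≡ φ i z → x ≡ z)
    (arc-TT : ∀ i j → toℕ i < toℕ j → ∀ x z → arc T (φ i x) (φ j z) ≡ true)
    (arc-vT : ∀ i j x → toℕ i ≤ toℕ j → arc T (v i) (φ j x) ≡ true)
    (arc-Tv : ∀ i j x → toℕ j < toℕ i → arc T (φ j x) (v i) ≡ true)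
    (arc-vv : ∀ i j → toℕ j < toℕ i → arc T (v i) (v j) ≡ true)
    where

    -- Each pair of different positions is given an arc in one direction only; `arc-asym` settles
    -- the other. As the ends of an arc are distinct, injectivity is assumed only inside a single
    -- copy.
    assemble-A : Contains T (λ _ → ⊤) (A (2 + k))
    assemble-A = f , f-inj , (λ _ → tt) , f-arc
      where
      f : AV (2 + k) → Fin N
      f (inj₁ (i , x)) = φ i x
      f (inj₂ i)       = v i

      f-arc : ∀ u w → arc T (f u) (f w) ≡ aArc (2 + k) u w
      f-arc (inj₁ (i , x)) (inj₁ (j , z)) with toℕ i ≟ toℕ j
      ... | yes eq with refl ← toℕ-injective eq = φ-arc i x z
      ... | no ne = arc-does (toℕ i <? toℕ j) (λ i<j → arc-TT i j i<j x z)
        λ i≮j → arc-asym (arc-TT j i (≤∧≢⇒< (≮⇒≥ i≮j) (ne ∘ sym)) z x)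
      f-arc (inj₁ (j , x)) (inj₂ i) = arc-does (toℕ j <? toℕ i) (arc-Tv i j x)
        λ j≮i → arc-asym (arc-vT i j x (≮⇒≥ j≮i))
      f-arc (inj₂ i) (inj₁ (j , x)) = arc-does (toℕ i ≤? toℕ j) (arc-vT i j x)
        λ i≰j → arc-asym (arc-Tv i j x (≰⇒> i≰j))
      f-arc (inj₂ i) (inj₂ j) = arc-does (toℕ j <? toℕ i) (arc-vv i j) back
        where
        back : ¬ toℕ j < toℕ i → arc T (v i) (v j) ≡ false
        back j≮i with m≤n⇒m<n∨m≡n (≮⇒≥ j≮i)
        ... | inj₁ i<j = arc-asym (arc-vv j i i<j)
        ... | inj₂ i≡j with refl ← toℕ-injective i≡j = irrefl T (v i)

      T≢v : ∀ j x i → φ j x ≢ v i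
      T≢v j x i with toℕ j <? toℕ i
      ... | yes j<i = arc⇒≢ (arc-Tv i j x j<i)
      ... | no  j≮i = arc⇒≢ (arc-vT i j x (≮⇒≥ j≮i)) ∘ sym

      f-inj : ∀ u w → f u ≡ f w → u ≡ w
      f-inj (inj₁ (i , x)) (inj₁ (j , z)) eq with <-cmp (toℕ i) (toℕ j)
      ... | tri< i<j _ _ = contradiction eq (arc⇒≢ (arc-TT i j i<j x z))
      ... | tri> _ _ j<i = contradiction (sym eq) (arc⇒≢ (arc-TT j i j<i z x))
      ... | tri≈ _ i≡j _ with refl ← toℕ-injective i≡j = cong (λ x → inj₁ (i , x)) (φ-inj i x z eq)
      f-inj (inj₁ (j , x)) (inj₂ i) eq = contradiction eq (T≢v j x i)
      f-inj (inj₂ i) (inj₁ (j , x)) eq = contradiction (sym eq) (T≢v j x i)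
      f-inj (inj₂ i) (inj₂ j) eq with <-cmp (toℕ i) (toℕ j)
      ... | tri< i<j _ _ = contradiction (sym eq) (arc⇒≢ (arc-vv j i i<j))
      ... | tri> _ _ j<i = contradiction eq (arc⇒≢ (arc-vv i j j<i))
      ... | tri≈ _ i≡j _ = cong inj₂ (toℕ-injective i≡j)

  -- Monotonicity and decidability of the clique number.

  OmegaLe-mono : ∀ {X Y k l} → (∀ {u} → X u → Y u) → k ≤ l → OmegaLe T Y k → OmegaLe T X l
  OmegaLe-mono X⊆Y k≤l (rank , inj , bound) = rank ,
    (λ u v Xu Xv → inj u v (X⊆Y Xu) (X⊆Y Xv)) ,
    λ s f (Xf , rest) → ≤-trans (bound s f ((λ i → X⊆Y (Xf i)) , rest)) k≤l

  OmegaLe-empty : ∀ {X k} → (∀ {u} → ¬ X u) → OmegaLe T X k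
  OmegaLe-empty ∅ = (λ _ → 0) , (λ u v Xu → contradiction Xu ∅) , λ
    { zero f _ → z≤n ; (suc s) f (Xf , _) → contradiction (Xf Fin.zero) ∅ }

  ¬OmegaLe⇒OmegaGe : ∀ {X c} → ¬ OmegaLe T X c → OmegaGe T X c
  ¬OmegaLe⇒OmegaGe ¬le k le = ≮⇒≥ λ k<c → ¬le (OmegaLe-mono (λ x → x) (<⇒≤ k<c) le)

  -- On the full vertex set membership is trivial, so a finite search decides. By `compress`,
  -- rankings with values up to `N` suffice, and a clique with more than `k` vertices restricts to
  -- one with exactly k+1, so only those are looked for.
  OmegaLe-⊤? : ∀ k → Dec (OmegaLe T (λ _ → ⊤) k)
  OmegaLe-⊤? k = map′ to from (anyVec? N λ ρ → Inj? ρ ×-dec ¬? (anyVec? (suc k) (Clique? ρ)))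
    where
    rk : Vec (Fin (suc N)) N → Fin N → ℕ
    rk ρ u = toℕ (lookup ρ u)
    Inj : Vec (Fin (suc N)) N → Set
    Inj ρ = ∀ u v → lookup ρ u ≡ lookup ρ v → u ≡ v
    Inj? : Decidable Inj
    Inj? ρ = all? λ u → all? λ v → (lookup ρ u Fin.≟ lookup ρ v) →-dec (u Fin.≟ v)
    Clique : Vec (Fin (suc N)) N → Vec (Fin N) (suc k) → Set
    Clique ρ f = IsBackClique T (λ _ → ⊤) (rk ρ) (suc k) (lookup f)
    Clique? : ∀ ρ → Decidable (Clique ρ)
    Clique? ρ f = yes (λ _ → tt) ×-dec
      (all? (λ i → all? λ j → (lookup f i Fin.≟ lookup f j) →-dec (i Fin.≟ j)) ×-dec
       all? (λ i → all? λ j → (rk ρ (lookup f i) <? rk ρ (lookup f j)) →-dec (arc T (lookup f j) (lookup f i) Bool.≟ true)))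
    to : ∃ (λ ρ → Inj ρ × ¬ ∃ (Clique ρ)) → OmegaLe T (λ _ → ⊤) k
    to (ρ , inj , ¬cl) = rk ρ , (λ u v _ _ eq → inj u v (toℕ-injective eq)) , λ s f (_ , finj , farc) →
      ≮⇒≥ λ k<s → let g = λ i → f (inject≤ i k<s) in ¬cl (tabulate g , (λ _ → tt) ,
        (λ i j eq → inject≤-injective k<s k<s i j (finj _ _ (subst₂ _≡_ (lookup∘tabulate g i) (lookup∘tabulate g j) eq))) ,
        λ i j → subst₂ (λ x y → rk ρ x < rk ρ y → arc T y x ≡ true)
          (sym (lookup∘tabulate g i)) (sym (lookup∘tabulate g j)) (farc _ _))
    from : OmegaLe T (λ _ → ⊤) k → ∃ (λ ρ → Inj ρ × ¬ ∃ (Clique ρ))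
    from (rank , inj , bound) = tabulate (compress rank) ,
      (λ u v eq → inj u v tt tt (compress-reflects-≡ rank
        (subst₂ _≡_ (lookup∘tabulate (compress rank) u) (lookup∘tabulate (compress rank) v) eq))) ,
      λ (f , _ , finj , farc) → <-irrefl refl (bound (suc k) (lookup f)
        ((λ _ → tt) , finj , λ i j lt → farc i j
          (subst₂ (λ x y → toℕ x < toℕ y)
            (sym (lookup∘tabulate (compress rank) (lookup f i)))
            (sym (lookup∘tabulate (compress rank) (lookup f j)))
            (compress-mono rank lt))))

  -- Backedge cliques as lists, and lexicographic orderings.

  BackCliqueList : VSet N → (Fin N → ℕ) → List (Fin N) → Set
  BackCliqueList X rank xs = All X xs × Unique xs ×
    (∀ {u v} → u ∈ₗ xs → v ∈ₗ xs → rank u < rank v → arc T v u ≡ true)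

  BackCliqueList-filter : ∀ {X rank xs} {P : Fin N → Set} (P? : Decidable P) →
    BackCliqueList X rank xs → BackCliqueList X rank (filter P? xs)
  BackCliqueList-filter P? (Xxs , uniq , arcs) = All.filter⁺ P? Xxs , Unique.filter⁺ P? uniq ,
    λ u∈ v∈ → arcs (proj₁ (∈-filter⁻ P? u∈)) (proj₁ (∈-filter⁻ P? v∈))

  -- Together with the converse below, this allows a clique to be handled as a list, which can be
  -- filtered and split.
  list-bound⁺ : ∀ {X rank k} → (∀ {xs} → BackCliqueList X rank xs → length xs ≤ k) →
    ∀ s f → IsBackClique T X rank s f → s ≤ k
  list-bound⁺ {rank = rank} bound s f (Xf , inj , arcs) = subst (_≤ _) (length-tabulate f)
    (bound (All.tabulate⁺ Xf , Unique.tabulate⁺ (inj _ _) , arcs′))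
    where
    arcs′ : ∀ {u v} → u ∈ₗ List.tabulate f → v ∈ₗ List.tabulate f → rank u < rank v → arc T v u ≡ true
    arcs′ u∈ v∈ with ∈-tabulate⁻ u∈ | ∈-tabulate⁻ v∈
    ... | i , refl | j , refl = arcs i j

  list-bound⁻ : ∀ {X rank k} → (∀ s f → IsBackClique T X rank s f → s ≤ k) →
    ∀ {xs} → BackCliqueList X rank xs → length xs ≤ k
  list-bound⁻ bound {xs} (Xxs , uniq , arcs) = bound (length xs) (List.lookup xs)
    ((λ i → All.lookup Xxs (∈-lookup i)) , lookup-injective uniq , λ i j → arcs (∈-lookup i) (∈-lookup j))

  record LexOrder (X : VSet N) (β : Fin N → ℕ) (C : ℕ → ℕ) : Set where
    field
      rank      : Fin N → ℕ
      injective : ∀ u v → X u → X v → rank u ≡ rank v → u ≡ v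
      refines   : ∀ {u v} → β u < β v → rank u < rank v
      bound     : ∀ {b xs} → BackCliqueList X rank xs → All (λ u → β u ≡ b) xs → length xs ≤ C b

  lexOrder : ∀ {X} β {C} → (∀ b → OmegaLe T (λ u → X u × β u ≡ b) (C b)) → LexOrder X β C
  lexOrder {X} β {C} fibre = record
    { rank = rank
    ; injective = inj
    ; refines = refines
    ; bound = λ {b} {xs} (Xxs , uniq , arcs) βxs → list-bound⁻ (proj₂ (proj₂ (fibre b)))
        ( All.zip (Xxs , βxs) , uniq
        , λ u∈ v∈ lt → arcs u∈ v∈ (lift (All.lookup βxs u∈) (All.lookup βxs v∈) lt))
    }
    where
    R : ℕ → Fin N → ℕ
    R b = proj₁ (fibre b)
    M : ℕ
    M = proj₁ (bounded λ u → R (β u) u)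
    R<M : ∀ u → R (β u) u < M
    R<M = proj₂ (bounded λ u → R (β u) u)
    rank : Fin N → ℕ
    -- `M` exceeds every rank taken within its own fibre, so `β` is the leading digit and the
    -- fibre's rank the last one.
    rank u = β u * M + R (β u) u
    refines : ∀ {u v} → β u < β v → rank u < rank v
    refines {u} {v} lt = begin-strict
      β u * M + R (β u) u <⟨ +-monoʳ-< (β u * M) (R<M u) ⟩
      β u * M + M         ≡⟨ +-comm (β u * M) M ⟩
      suc (β u) * M       ≤⟨ *-monoˡ-≤ M lt ⟩
      β v * M             ≤⟨ m≤m+n _ _ ⟩
      rank v              ∎
      where open ≤-Reasoning
    lift : ∀ {u v b} → β u ≡ b → β v ≡ b → R b u < R b v → rank u < rank v
    lift {u} {v} refl eq lt rewrite eq = +-monoʳ-< (β u * M) lt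
    inj : ∀ u v → X u → X v → rank u ≡ rank v → u ≡ v
    inj u v Xu Xv eq with <-cmp (β u) (β v)
    ... | tri< lt _ _ = contradiction eq (<⇒≢ (refines lt))
    ... | tri> _ _ gt = contradiction (sym eq) (<⇒≢ (refines gt))
    ... | tri≈ _ e _  = proj₁ (proj₂ (fibre (β u))) u v (Xu , refl) (Xv , sym e)
      (+-cancelˡ-≡ (β u * M) _ _ (subst (λ b → rank u ≡ b * M + R b v) (sym e) eq))

  -- Pigeonhole by peeling: the vertices with the smallest value of `β` number at most `C`. Remove
  -- them and recurse; if the rest supplies h+1 vertices with increasing values, the minimum `z`
  -- goes in front of them.
  spread : ∀ {X rank} (β : Fin N → ℕ) C →
    (∀ {b xs} → BackCliqueList X rank xs → All (λ u → β u ≡ b) xs → length xs ≤ C) →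
    ∀ h {xs} → BackCliqueList X rank xs → length xs ≤ h * C ⊎
      Σ (ℕ → Fin N) λ y → (∀ {i} → i ≤ h → y i ∈ₗ xs) × (∀ {i j} → i < j → j ≤ h → β (y i) < β (y j))
  spread β C bound h {[]} cl = inj₁ z≤n
  spread β C bound zero {x ∷ xs} cl = inj₂ ((λ _ → x) , (λ _ → here refl) , λ { () z≤n })
  spread β C bound (suc h) {x ∷ xs} cl = [ small , large ]′ (spread β C bound h (BackCliqueList-filter above? cl))
    where
    z : Fin N
    z = argmin β x xs
    z∈ : z ∈ₗ x ∷ xs
    z∈ = [ here , there ]′ (argmin-sel β x xs)
    z-min : All (λ u → β z ≤ β u) (x ∷ xs)
    z-min = f[argmin]≤f[⊤] {f = β} x xs ∷ f[argmin]≤f[xs] {f = β} x xs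
    above? : Decidable (λ u → β z < β u)
    above? u = β z <? β u
    fibre : All (λ u → β u ≡ β z) (filter (¬? ∘ above?) (x ∷ xs))
    fibre = All.tabulate λ u∈ → let (u∈xs , ≮) = ∈-filter⁻ (¬? ∘ above?) {xs = x ∷ xs} u∈ in
      ≤-antisym (≮⇒≥ ≮) (All.lookup z-min u∈xs)
    small : _ → _
    small le = inj₁ (subst (_≤ suc h * C)
      (trans (+-comm (length (filter (¬? ∘ above?) (x ∷ xs))) _) (sym (length-filter-split above? (x ∷ xs))))
      (+-mono-≤ (bound (BackCliqueList-filter (¬? ∘ above?) cl) fibre) le))
    large : _ → _
    large (y , y∈ , y<) = inj₂ (y′ , (λ {i} → y′∈ {i}) , λ {i} {j} → y′< {i} {j})
      where
      y′ : ℕ → Fin N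
      y′ zero    = z
      y′ (suc i) = y i
      y′∈ : ∀ {i} → i ≤ suc h → y′ i ∈ₗ x ∷ xs
      y′∈ {zero}  _        = z∈
      y′∈ {suc i} (s≤s le) = proj₁ (∈-filter⁻ above? {xs = x ∷ xs} (y∈ le))
      y′< : ∀ {i j} → i < j → j ≤ suc h → β (y′ i) < β (y′ j)
      y′< {zero}  {suc j} _        (s≤s le) = proj₂ (∈-filter⁻ above? {xs = x ∷ xs} (y∈ le))
      y′< {suc i} {suc j} (s≤s lt) (s≤s le) = y< lt le

  -- Unions of vertex sets, with excluded middle at hand.

  module _ (lem : (P : Set) → Dec P) where

    -- Place the vertices of `X` before the others: a clique then has at most `k` vertices in `X`
    -- and at most `l` outside it.
    OmegaLe-union : ∀ {X Y Z : VSet N} {k l} → (∀ {u} → Z u → X u ⊎ Y u) →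
      OmegaLe T X k → OmegaLe T Y l → OmegaLe T Z (k + l)
    OmegaLe-union {X} {Y} {Z} {k} {l} cover Xk Yl = rank , injective , list-bound⁺ total
      where
      index : ∀ {P : Set} → Dec P → ℕ
      index (yes _) = 0
      index (no  _) = 1
      β : Fin N → ℕ
      β u = index (lem (X u))
      C : ℕ → ℕ
      C zero    = k
      C (suc _) = l
      β0 : ∀ {u} → β u ≡ 0 → X u
      β0 {u} eq with lem (X u)
      β0 {u} _ | yes Xu = Xu
      β1 : ∀ {u b} → Z u → β u ≡ suc b → Y u
      β1 {u} Zu eq with lem (X u)
      β1 {u} Zu _ | no ¬Xu = [ (λ Xu → contradiction Xu ¬Xu) , (λ y → y) ]′ (cover Zu)
      β≢0 : ∀ {u} → β u ≢ 0 → β u ≡ 1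
      β≢0 {u} ne with lem (X u)
      ... | yes _ = contradiction refl ne
      ... | no  _ = refl
      fibre : ∀ b → OmegaLe T (λ u → Z u × β u ≡ b) (C b)
      fibre zero    = OmegaLe-mono (β0 ∘ proj₂) ≤-refl Xk
      fibre (suc b) = OmegaLe-mono (λ (Zu , eq) → β1 Zu eq) ≤-refl Yl
      open LexOrder (lexOrder β fibre)
      zero? : Decidable (λ u → β u ≡ 0)
      zero? u = β u ≟ 0
      total : ∀ {xs} → BackCliqueList Z rank xs → length xs ≤ k + l
      total {xs} cl = subst (_≤ k + l) (sym (length-filter-split zero? xs)) (+-mono-≤
        (bound (BackCliqueList-filter zero? cl) (All.all-filter zero? xs))
        (bound (BackCliqueList-filter (¬? ∘ zero?) cl) (All.map β≢0 (All.all-filter (¬? ∘ zero?) xs))))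

    -- Division of the chain, given by a level function, into blocks.

    module _ (U : VSet N) (lev : Fin N → ℕ) (c a r : ℕ) (lev<r : ∀ {u} → U u → lev u < r)
      (bag : ∀ i → OmegaLe T (λ u → U u × lev u ≡ i) c)
      (inAbove : ∀ {v} → U v → OmegaLe T (λ u → arc T u v ≡ true × U u × lev v < lev u) a)
      (outBelow : ∀ {v} → U v → OmegaLe T (λ u → arc T v u ≡ true × U u × lev u < lev v) a)
      where

      Window : ℕ → ℕ → VSet N
      Window s t u = U u × s ≤ lev u × lev u < t

      -- The bag `t` that lifts the clique number above `c` stays in the block it closes, and the
      -- new block begins one bag later.
      next : ∀ {P : Set} → ℕ → ℕ → Dec P → ℕ
      next s t (yes _) = s
      next s t (no  _) = suc t

      -- start t is the first bag of the block containing bag t, and serves as the name of that block.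
      start : ℕ → ℕ
      start zero    = zero
      start (suc t) = next (start t) t (lem (OmegaLe T (Window (start t) (suc t)) c))

      start-≤ : ∀ t → start t ≤ t
      start-≤ zero = z≤n
      start-≤ (suc t) with lem (OmegaLe T (Window (start t) (suc t)) c)
      ... | yes _ = m≤n⇒m≤1+n (start-≤ t)
      ... | no  _ = ≤-refl

      start-step : ∀ t → start t ≤ start (suc t)
      start-step t with lem (OmegaLe T (Window (start t) (suc t)) c)
      ... | yes _ = ≤-refl
      ... | no  _ = m≤n⇒m≤1+n (start-≤ t)

      start-mono : ∀ {i j} → i ≤ j → start i ≤ start j
      start-mono {i} {zero} z≤n = ≤-refl
      start-mono {i} {suc j} i≤1+j with m≤n⇒m<n∨m≡n i≤1+j
      ... | inj₁ (s≤s i≤j) = ≤-trans (start-mono i≤j) (start-step j)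
      ... | inj₂ refl      = ≤-refl

      start-reflects-< : ∀ i j → start i < start j → i < j
      start-reflects-< i j lt = ≰⇒> λ j≤i → <⇒≱ lt (start-mono j≤i)

      start-constant : ∀ t {i} → start t ≤ i → i ≤ t → start i ≡ start t
      start-constant t {i} s≤i i≤t with m≤n⇒m<n∨m≡n i≤t
      start-constant t s≤i i≤t | inj₂ refl = refl
      start-constant (suc t) s≤i i≤t | inj₁ (s≤s i≤t′) with lem (OmegaLe T (Window (start t) (suc t)) c)
      ... | yes _ = start-constant t s≤i i≤t′
      ... | no  _ = contradiction i≤t′ (<⇒≱ s≤i)

      -- Before bag `t` joins its block, either the last test succeeded or the window is still
      -- empty.
      current-small : ∀ t → OmegaLe T (Window (start t) t) c
      current-small zero = OmegaLe-empty λ { (_ , _ , ()) }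
      current-small (suc t) with lem (OmegaLe T (Window (start t) (suc t)) c)
      ... | yes le = le
      ... | no  _  = OmegaLe-empty λ (_ , ge , lt) → <⇒≱ lt ge

      current-bound : ∀ t → OmegaLe T (Window (start t) (suc t)) (c + c)
      current-bound t = OmegaLe-union split (current-small t) (bag t)
        where
        split : ∀ {u} → Window (start t) (suc t) u → Window (start t) t u ⊎ (U u × lev u ≡ t)
        split (Uu , ge , s≤s le) with m≤n⇒m<n∨m≡n le
        ... | inj₁ lt = inj₁ (Uu , ge , lt)
        ... | inj₂ eq = inj₂ (Uu , eq)

      blk : Fin N → ℕ
      blk u = start (lev u)

      Block : ℕ → VSet N
      Block b u = U u × blk u ≡ b

      -- Induction over the bags below `t`. If bag `t` belongs to block `b`, all of the block up to
      -- this bag lies in the current window; otherwise the bag adds nothing.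
      block-bound : ∀ b → OmegaLe T (Block b) (c + c)
      block-bound b = OmegaLe-mono (λ (Uu , eq) → Uu , eq , lev<r Uu) ≤-refl (prefix r)
        where
        prefix : ∀ t → OmegaLe T (λ u → U u × blk u ≡ b × lev u < t) (c + c)
        prefix zero = OmegaLe-empty λ { (_ , _ , ()) }
        prefix (suc t) with start t ≟ b
        ... | yes refl = OmegaLe-mono (λ {u} (Uu , eq , lt) → Uu , subst (_≤ lev u) eq (start-≤ (lev u)) , lt)
                ≤-refl (current-bound t)
        ... | no ne = OmegaLe-mono (λ { {u} (Uu , eq , s≤s le) →
                Uu , eq , ≤∧≢⇒< le λ e → ne (trans (cong start (sym e)) eq) }) ≤-refl (prefix t)

      -- Induction on the distance `d` finds the bag after which `start` leaves the value `start i`.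
      -- The test failed there, and the window it tested is contained in the block.
      closed-block-large : ∀ i d → start i ≢ start (d + i) → OmegaGe T (Block (start i)) c
      closed-block-large i zero    ne = contradiction refl ne
      closed-block-large i (suc d) ne with start i ≟ start (d + i)
      ... | no ne′ = closed-block-large i d ne′
      ... | yes eq with lem (OmegaLe T (Window (start (d + i)) (suc (d + i))) c)
      ...   | yes _  = contradiction eq ne
      ...   | no ¬le = ¬OmegaLe⇒OmegaGe λ le → ¬le (OmegaLe-mono
                (λ { {u} (Uu , ge , s≤s lt) → Uu , trans (start-constant (d + i) ge lt) (sym eq) }) ≤-refl le)

      nonlast-block-large : ∀ {u v} → blk u < blk v → OmegaGe T (Block (blk u)) c
      nonlast-block-large {u} {v} lt = closed-block-large (lev u) (lev v ∸ lev u)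
        λ eq → <⇒≢ lt (trans eq (cong start (m∸n+n≡m (<⇒≤ (start-reflects-< (lev u) (lev v) lt)))))

      -- Pruning a block with respect to vertices outside it.

      Forward : ℕ → Fin N → Fin N → Set
      Forward b u w = (blk w < b → arc T w u ≡ true) × (b < blk w → arc T u w ≡ true)

      -- The two neighbourhood conditions of a near-bag-chain: for `w` in an earlier block the
      -- exceptions are in-neighbours of `w` at higher levels, for `w` in a later block they are
      -- out-neighbours at lower levels.
      backward-bound : ∀ b {w} → U w → OmegaLe T (λ u → Block b u × ¬ Forward b u w) a
      backward-bound b {w} Uw with <-cmp (blk w) b
      ... | tri< lt _ ≯ = OmegaLe-mono before ≤-refl (inAbove Uw)
        where
        before : ∀ {u} → Block b u × ¬ Forward b u w → arc T u w ≡ true × U u × lev w < lev u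
        before {u} ((Uu , refl) , bad) =
          arc-flip (λ { refl → <-irrefl refl lt }) (λ wu → bad ((λ _ → wu) , λ gt → contradiction gt ≯)) ,
          Uu , start-reflects-< (lev w) (lev u) lt
      ... | tri≈ ≮ _ ≯ = OmegaLe-empty λ (_ , bad) → bad ((λ lt → contradiction lt ≮) , λ gt → contradiction gt ≯)
      ... | tri> ≮ _ gt = OmegaLe-mono after ≤-refl (outBelow Uw)
        where
        after : ∀ {u} → Block b u × ¬ Forward b u w → arc T w u ≡ true × U u × lev u < lev w
        after {u} ((Uu , refl) , bad) =
          arc-flip (λ { refl → <-irrefl refl gt }) (λ uw → bad ((λ lt → contradiction lt ≮) , λ _ → uw)) ,
          Uu , start-reflects-< (lev u) (lev w) gt

      -- Each vertex of `L` costs at most `a`. The claim is about upper bounds because `OmegaGe`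
      -- quantifies over these; `pruned-large` is the version for lower bounds.
      prune : ∀ b {k} L → All U L → OmegaLe T (λ u → Block b u × All (Forward b u) L) k →
        OmegaLe T (Block b) (k + length L * a)
      prune b {k} [] [] le = OmegaLe-mono (λ Bu → Bu , []) (m≤m+n k 0) le
      prune b {k} (w ∷ L) (Uw ∷ UL) le = subst (OmegaLe T (Block b)) (+-assoc k a _)
        (prune b L UL (OmegaLe-union split le (backward-bound b Uw)))
        where
        split : ∀ {u} → Block b u × All (Forward b u) L →
          (Block b u × All (Forward b u) (w ∷ L)) ⊎ (Block b u × ¬ Forward b u w)
        split {u} (Bu , fwd) with lem (Forward b u w)
        ... | yes p = inj₁ (Bu , p ∷ fwd)
        ... | no ¬p = inj₂ (Bu , ¬p)

      pruned-large : ∀ b {d} L → All U L → OmegaGe T (Block b) c → length L * a + d ≤ c →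
        OmegaGe T (λ u → Block b u × All (Forward b u) L) d
      pruned-large b {d} L UL ge le k ok = +-cancelˡ-≤ (length L * a) d k
        (≤-trans le (subst (c ≤_) (+-comm k _) (ge _ (prune b L UL ok))))

      -- Finding the copies T_i in alternate blocks.

      module Copies {H : Pattern} {vs : List (Vtx H)} (complete : ∀ x → x ∈ₗ vs) {m d s : ℕ}
        (copy : ∀ X → OmegaGe T X d → Contains T X H)
        (size : ∀ {p} → p < m → p * length vs + m ≤ s) (large : s * a + d ≤ c)
        (y : ℕ → Fin N) (y∈U : ∀ {i} → i ≤ 2 * m → U (y i))
        (blk-y : ∀ {i j} → i < j → j ≤ 2 * m → blk (y i) < blk (y j))
        where

        -- The vertices E i become v_i, and the copy T_i is found in the block of O i.
        E O : ℕ → Fin N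
        E i = y (2 * i)
        O i = y (suc (2 * i))

        E-range : ∀ {i} → i < m → 2 * i ≤ 2 * m
        E-range i<m = *-monoʳ-≤ 2 (<⇒≤ i<m)

        O-range : ∀ {i} → i < m → suc (suc (2 * i)) ≤ 2 * m
        O-range {i} i<m = subst (_≤ 2 * m) (*-suc 2 i) (*-monoʳ-≤ 2 i<m)

        blk-E<O : ∀ {i j} → i ≤ j → j < m → blk (E i) < blk (O j)
        blk-E<O i≤j j<m = blk-y (s≤s (*-monoʳ-≤ 2 i≤j)) (<⇒≤ (O-range j<m))

        blk-O<E : ∀ {i j} → i < j → j < m → blk (O i) < blk (E j)
        blk-O<E {i} {j} i<j j<m = blk-y (subst (_≤ 2 * j) (*-suc 2 i) (*-monoʳ-≤ 2 i<j)) (E-range j<m)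

        blk-O<O : ∀ {i j} → i < j → j < m → blk (O i) < blk (O j)
        blk-O<O i<j j<m = <-trans (blk-O<E i<j j<m) (blk-E<O ≤-refl j<m)

        record IsCopy (p : ℕ) (φ : Vtx H → Fin N) : Set where
          field
            inBlock : ∀ x → Block (blk (O p)) (φ x)
            -- All `i` below `m` are included, also those beyond `p`, since the vertices v_i are
            -- fixed before any copy is chosen.
            forward : ∀ x {i} → i < m → Forward (blk (O p)) (φ x) (E i)
            arcs    : ∀ x z → arc T (φ x) (φ z) ≡ parc H x z
            inj     : ∀ x z → φ x ≡ φ z → x ≡ z

        _⇒_ : (φ ψ : Vtx H → Fin N) → Set
        φ ⇒ ψ = ∀ x z → arc T (φ x) (ψ z) ≡ true

        -- The block of `O p` is pruned against all v_i and all vertices of the earlier copies, at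
        -- most `s` vertices in total. What remains has clique number at least `d`, hence contains
        -- `H`.
        extend : ∀ p → p < m → (φ : ℕ → Vtx H → Fin N) → (∀ {j} → j < p → IsCopy j (φ j)) →
          Σ (Vtx H → Fin N) λ ψ → IsCopy p ψ × (∀ {j} → j < p → φ j ⇒ ψ)
        extend p p<m φ copies = ψ , isCopy , related
          where
          es ws : List (Fin N)
          es = map E (upTo m)
          ws = concatMap (λ j → map (φ j) vs) (upTo p)
          U-es : All U es
          U-es = All.map⁺ (All.tabulate λ i∈ → y∈U (E-range (∈-upTo⁻ i∈)))
          U-ws : All U ws
          U-ws = All.concat⁺ (All.map⁺ (All.tabulate λ j∈ → All.map⁺ (All.tabulate λ {x} _ →
            proj₁ (IsCopy.inBlock (copies (∈-upTo⁻ j∈)) x))))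
          fits : length (es ++ ws) ≤ s
          fits = begin
            length (es ++ ws)                     ≡⟨ length-++ es ⟩
            length es + length ws                 ≡⟨ +-comm (length es) (length ws) ⟩
            length ws + length es                 ≡⟨ cong₂ _+_
              (length-concatMap (λ j → map (φ j) vs) (length vs) (λ j → length-map (φ j) vs) (upTo p))
              (length-map E (upTo m)) ⟩
            length (upTo p) * length vs + length (upTo m) ≡⟨ cong₂ (λ l l′ → l * length vs + l′) (length-upTo p) (length-upTo m) ⟩
            p * length vs + m                     ≤⟨ size p<m ⟩
            s                                     ∎
            where open ≤-Reasoning
          found : Contains T (λ u → Block (blk (O p)) u × All (Forward (blk (O p)) u) (es ++ ws)) H
          found = copy _ (pruned-large (blk (O p)) (es ++ ws) (All.++⁺ U-es U-ws)
            -- A block is known to be large only if a later one exists. Here `y (2p+2)` lies in a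
            -- later block, which for the last `p` is the reason for having a vertex `y (2m)`.
            (nonlast-block-large {O p} {y (suc (suc (2 * p)))} (blk-y ≤-refl (O-range p<m)))
            (≤-trans (+-monoˡ-≤ d (*-monoˡ-≤ a fits)) large))
          ψ : Vtx H → Fin N
          ψ = proj₁ found
          ψ∈ : ∀ x → Block (blk (O p)) (ψ x) × All (Forward (blk (O p)) (ψ x)) (es ++ ws)
          ψ∈ = proj₁ (proj₂ (proj₂ found))
          isCopy : IsCopy p ψ
          isCopy = record
            { inBlock = λ x → proj₁ (ψ∈ x)
            ; forward = λ x i<m → All.lookup (proj₂ (ψ∈ x)) (∈-++⁺ˡ (∈-map⁺ E (∈-upTo⁺ i<m)))
            ; arcs    = proj₂ (proj₂ (proj₂ found))
            ; inj     = proj₁ (proj₂ found)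
            }
          related : ∀ {j} → j < p → φ j ⇒ ψ
          related {j} j<p x z = proj₁ (All.lookup (proj₂ (ψ∈ z)) φx∈)
            (subst (_< blk (O p)) (sym (proj₂ (IsCopy.inBlock (copies j<p) x))) (blk-O<O j<p p<m))
            where
            φx∈ : φ j x ∈ₗ es ++ ws
            φx∈ = ∈-++⁺ʳ es (∈-concatMap⁺ (λ j → map (φ j) vs) (lose (∈-upTo⁺ j<p) (∈-map⁺ (φ j) (complete x))))

        copies : Σ (ℕ → Vtx H → Fin N) λ φ →
          (∀ {j} → j < m → IsCopy j (φ j)) × (∀ {i j} → i < j → j < m → φ i ⇒ φ j)
        copies = sequence {Good = IsCopy} {R = _⇒_} (λ _ → y 0) m extend

      -- From a long backedge clique to A_m.

      -- Back edges make later clique vertices point to earlier ones, as the v_i of A_m do. Since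
      -- v_i lies in an earlier block than T_j exactly when i ≤ j, the arcs between them are right
      -- once they are forward.
      contains-A : ∀ {k d} → (∀ X → OmegaGe T X d → Contains T X (A (suc k))) →
        2 * ((2 + k) !) * a + d ≤ c → (y : ℕ → Fin N) → (∀ {i} → i ≤ 2 * (2 + k) → U (y i)) →
        (∀ {i j} → i < j → j ≤ 2 * (2 + k) → blk (y i) < blk (y j)) →
        (∀ {i j} → i < j → j ≤ 2 * (2 + k) → arc T (y j) (y i) ≡ true) →
        Contains T (λ _ → ⊤) (A (2 + k))
      contains-A {k} {d} copy large y y∈U blk-y arc-y = assemble-A (E ∘ toℕ) (λ i → φ (toℕ i))
        (λ i → IsCopy.arcs (isCopy i)) (λ i → IsCopy.inj (isCopy i))
        (λ i j i<j → proj₂ (proj₂ copies) i<j (m<n⇒m<1+n (toℕ<n j)))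
        (λ i j x i≤j → proj₁ (IsCopy.forward (isCopy j) x (toℕ<n i)) (blk-E<O i≤j (m<n⇒m<1+n (toℕ<n j))))
        (λ i j x j<i → proj₂ (IsCopy.forward (isCopy j) x (toℕ<n i)) (blk-O<E j<i (toℕ<n i)))
        (λ i j j<i → arc-y (*-monoʳ-< 2 j<i) (E-range (toℕ<n i)))
        where
        vs : Σ (List (AV (suc k))) λ xs → (∀ x → x ∈ₗ xs) × length xs ≤ 2 * (suc k !)
        vs = A-vertices (suc k)

        size : ∀ {p} → p < 2 + k → p * length (proj₁ vs) + (2 + k) ≤ 2 * ((2 + k) !)
        size (s≤s p≤1+k) = A-size-step k p≤1+k (proj₂ (proj₂ vs))

        open Copies {H = A (suc k)} (proj₁ (proj₂ vs)) {s = 2 * ((2 + k) !)} copy size large y y∈U blk-y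

        φ : ℕ → AV (suc k) → Fin N
        φ = proj₁ copies

        isCopy : ∀ (i : Fin (suc k)) → IsCopy (toℕ i) (φ (toℕ i))
        isCopy i = proj₁ (proj₂ copies) (m<n⇒m<1+n (toℕ<n i))

      chain-bound : ∀ {k d} → ¬ Contains T (λ _ → ⊤) (A (2 + k)) →
        (∀ X → OmegaGe T X d → Contains T X (A (suc k))) →
        2 * ((2 + k) !) * a + d ≤ c → OmegaLe T U (2 * (2 + k) * (c + c))
      chain-bound {k} ¬A copy large = rank , injective , list-bound⁺ total
        where
        open LexOrder (lexOrder blk block-bound)
        total : ∀ {xs} → BackCliqueList U rank xs → length xs ≤ 2 * (2 + k) * (c + c)
        total cl@(Uxs , _ , arcs) with spread blk (c + c) bound (2 * (2 + k)) cl
        ... | inj₁ le = le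
        ... | inj₂ (y , y∈ , blk-y) = contradiction
          (contains-A copy large y (λ i≤ → All.lookup Uxs (y∈ i≤)) blk-y
            λ i<j j≤ → arcs (y∈ (≤-trans (<⇒≤ i<j) j≤)) (y∈ j≤) (refines (blk-y i<j j≤)))
          ¬A

-- Excluded middle, and the passage from bags to levels.

AV-root : ∀ k → AV (suc k)
AV-root zero    = tt
AV-root (suc k) = inj₂ Fin.zero

-- OmegaGe is stable under double negation, so the set of all vertices for which P is decided
-- still satisfies it; any vertex of the copy found in that set carries a decision of P.
lem-from-copies : ∀ {N k d} (T : Tournament N) → (∀ X → OmegaGe T X d → Contains T X (A (suc k))) →
  OmegaGe T (λ _ → ⊤) d → (P : Set) → Dec P
lem-from-copies {k = k} {d} T copy ge P = proj₁ (proj₂ (proj₂ found)) (AV-root k)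
  where
  found : Contains T (λ _ → Dec P) (A (suc k))
  found = copy (λ _ → Dec P) λ l le → ≮⇒≥ λ l<d →
    ¬¬-excluded-middle λ P? → <⇒≱ l<d (ge l (OmegaLe-mono T (λ _ → P?) ≤-refl le))

module _ {N : ℕ} (T : Tournament N) (lem : (P : Set) → Dec P) {c a r : ℕ} {Q : Fin r → VSet N} where

  level : ∀ {u} → Dec (UnionAll Q u) → ℕ
  level (yes (i , _)) = toℕ i
  -- A default: all claims about levels are restricted to the union of the bags.
  level (no _)        = 0

  near-bag-chain-bound : ∀ {k d} → ¬ Contains T (λ _ → ⊤) (A (2 + k)) →
    (∀ X → OmegaGe T X d → Contains T X (A (suc k))) →
    2 * ((2 + k) !) * a + d ≤ c → NearBagChain T c a r Q → OmegaLe T (UnionAll Q) (2 * (2 + k) * (c + c))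
  near-bag-chain-bound ¬A copy large (disjoint , bags , ins , outs) =
    chain-bound T lem (UnionAll Q) lev c a r lev<r bag inAbove outBelow ¬A copy large
    where
    lev : Fin N → ℕ
    lev u = level (lem (UnionAll Q u))
    lev-spec : ∀ {u i} → Q i u → lev u ≡ toℕ i
    lev-spec {u} {i} Qu with lem (UnionAll Q u)
    -- Disjointness identifies the bag picked by `lem` with the given one.
    ... | yes (j , Qju) = cong toℕ (disjoint j i u Qju Qu)
    ... | no ¬Uu        = contradiction (i , Qu) ¬Uu
    lev<r : ∀ {u} → UnionAll Q u → lev u < r
    lev<r (i , Qu) = subst (_< r) (sym (lev-spec Qu)) (toℕ<n i)
    bag : ∀ i → OmegaLe T (λ u → UnionAll Q u × lev u ≡ i) c
    bag i with i <? r
    ... | yes i<r = OmegaLe-mono T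
      (λ { {u} ((j , Qu) , eq) → subst (λ j → Q j u)
        (toℕ-injective (trans (sym (lev-spec Qu)) (trans eq (sym (toℕ-fromℕ< i<r))))) Qu }) ≤-refl (bags (fromℕ< i<r))
    ... | no i≮r = OmegaLe-empty T λ (Uu , eq) → i≮r (subst (_< r) eq (lev<r Uu))
    inAbove : ∀ {v} → UnionAll Q v → OmegaLe T (λ u → arc T u v ≡ true × UnionAll Q u × lev v < lev u) a
    inAbove {v} (i , Qv) = OmegaLe-mono T
      (λ { (uv , (j , Qu) , lt) → uv , j , subst₂ _<_ (lev-spec Qv) (lev-spec Qu) lt , Qu }) ≤-refl (ins i v Qv)
    outBelow : ∀ {v} → UnionAll Q v → OmegaLe T (λ u → arc T v u ≡ true × UnionAll Q u × lev u < lev v) a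
    outBelow {v} (i , Qv) = OmegaLe-mono T
      (λ { (vu , (j , Qu) , lt) → vu , j , subst₂ _<_ (lev-spec Qu) (lev-spec Qv) lt , Qu }) ≤-refl (outs i v Qv)

theorem6p7 : (m n csmall : ℕ) → 2 ≤ m → 2 ≤ n →
    (N : ℕ) (T : Tournament N) →
    ¬ Contains T (λ _ → ⊤) (A m) → ¬ Contains T (λ _ → ⊤) (D n) →
    (∀ (X : VSet N) → OmegaGe T X csmall →
    Contains T X (A (m ∸ 1)) × Contains T X (D (n ∸ 1))) →
    (c a : ℕ) → 2 * (m !) * a + csmall ≤ c →
    (r : ℕ) (Q : Fin r → VSet N) → NearBagChain T c a r Q →
    OmegaLe T (UnionAll Q) (4 * m * c)
theorem6p7 (suc (suc k)) n csmall _ _ N T ¬A _ copies c a large r Q chain =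
  case OmegaLe-⊤? T csmall of λ where
    -- Here the bound follows from `csmall ≤ c ≤ 4 * m * c`.
    (yes le) → OmegaLe-mono T (λ _ → tt) (≤-trans (m+n≤o⇒n≤o (2 * (m !) * a) large) (m≤n*m c (4 * m))) le
    (no ¬le) → subst (OmegaLe T (UnionAll Q)) bound-eq
      (near-bag-chain-bound T (lem-from-copies T copy (¬OmegaLe⇒OmegaGe T ¬le)) ¬A copy large chain)
  where
  m : ℕ
  m = suc (suc k)
  copy : ∀ X → OmegaGe T X csmall → Contains T X (A (suc k))
  copy X ge = proj₁ (copies X ge)
  bound-eq : 2 * m * (c + c) ≡ 4 * m * c
  bound-eq = solve 2 (λ m c → con 2 :* m :* (c :+ c) := con 4 :* m :* c) refl m c
theorem6p7 (suc zero) n csmall (s≤s ())
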